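{- Let $\Sigma_n$ be an empty signature with sorts $S=\{\sigma_1,\dots,\sigma_n\}$, let $\Sigma^n_s$ be the signature with sorts $S$ and a single function symbol $s$ of arity $\sigma_1\to\sigma_1$, let $\mathcal{T}$ be a $\Sigma_n$-theory, and let $\mathcal{T}'$ be the $\Sigma^n_s$-theory axiomatized by $Ax(\mathcal{T})\cup\{\psi_\vee\}$, where $\psi_\vee=\forall x.\,[(s(s(x))=x)\vee(s(s(x))=s(x))]$ with $x$ of sort $\sigma_1$. Then $\mathcal{T}$ has the finite model property with respect to $S$ iff $\mathcal{T}'$ has the finite model property with respect to $S$; and $\mathcal{T}$ is stably finite with respect to $S$ iff $\mathcal{T}'$ is stably finite with respect to $S$.
   Context: An empty signature has no function symbols and only equality predicates (interpreted as identity). A $\Sigma$-interpretation is a structure (nonempty domain $\tau^{\mathcal{A}}$ per sort $\tau$) plus values for variables; a $\Sigma$-theory $\mathcal{T}$ is the class of all $\Sigma$-interpretations satisfying a set $Ax(\mathcal{T})$ of closed formulas (its $\mathcal{T}$-interpretations); $\mathcal{T}$-satisfiable means satisfied by some $\mathcal{T}$-interpretation. Finite model property w.r.t. $S$: every $\mathcal{T}$-satisfiable quantifier-free formula is satisfied by a $\mathcal{T}$-interpretation $\mathcal{A}$ with $\tau^{\mathcal{A}}$ finite for each $\tau\in S$. Stably finite w.r.t. $S$: for every quantifier-free $\phi$ and $\mathcal{T}$-interpretation $\mathcal{A}$ satisfying $\phi$, some $\mathcal{T}$-interpretation $\mathcal{B}$ satisfies $\phi$ with $|\tau^{\mathcal{B}}|$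 finite and $|\tau^{\mathcal{B}}|\le|\tau^{\mathcal{A}}|$ for each $\tau\in S$. -}

module Defs where

open import Data.Empty using (⊥; ⊥-elim)
open import Data.Fin.Base using (Fin)
open import Data.List.Base using (List; []; _∷_)
open import Data.List.Relation.Unary.All using (All; []; _∷_)
open import Data.Nat.Base using (ℕ)
open import Data.Product.Base using (_×_; ∃-syntax)
open import Data.Sum.Base using (_⊎_)
open import Data.Unit.Base using (⊤; tt)
open import Function.Bundles using (_↔_; _↣_)
open import Level using (0ℓ)
open import Relation.Binary.PropositionalEquality.Core using (_≡_)
open import Relation.Nullary.Negation.Core using (¬_)
open import Relation.Unary using (Pred; _∈_)

-- Equality is not listed among the predicate symbols: it is a logical symbol,
-- available at every sort.
record Signature (Sort : Set) : Set₁ where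
  field
    Fun  : Set
    dom  : Fun → List Sort
    cod  : Fun → Sort
    Rel  : Set
    args : Rel → List Sort

-- Formulas are well scoped: V σ is the type of the variables of sort σ that
-- may occur free, and a quantifier over τ adds one new variable of sort τ.

data _▸_ {Sort : Set} (V : Sort → Set) (τ : Sort) : Sort → Set where
  new : (V ▸ τ) τ
  old : ∀ {σ} → V σ → (V ▸ τ) σ

-- The global supply of variables: countably many of each sort.
Var : {Sort : Set} → Sort → Set
Var _ = ℕ

module Syntax {Sort : Set} (Sg : Signature Sort) where

  open Signature Sg

  data Term (V : Sort → Set) : Sort → Set where
    var : ∀ {σ} → V σ → Term V σ
    app : (f : Fun) → All (Term V) (dom f) → Term V (cod f)

  infix  7 _≐_
  infix  6 ¬′_
  infixr 5 _∧′_
  infixr 4 _∨′_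
  infixr 3 _⇒′_

  data Formula (V : Sort → Set) : Set where
    _≐_            : ∀ {σ} → Term V σ → Term V σ → Formula V
    rel            : (p : Rel) → All (Term V) (args p) → Formula V
    ¬′_            : Formula V → Formula V
    _∧′_ _∨′_ _⇒′_ : Formula V → Formula V → Formula V
    ∀′ ∃′          : (τ : Sort) → Formula (V ▸ τ) → Formula V

  Sentence : Set
  Sentence = Formula (λ _ → ⊥)

  Theory : Set₁
  Theory = Pred Sentence 0ℓ

open Syntax public

module _ {Sort : Set} {Sg : Signature Sort} where

  data QuantifierFree {V : Sort → Set} : Formula Sg V → Set where
    _≐_  : ∀ {σ} (t u : Term Sg V σ) → QuantifierFree (t ≐ u)
    rel  : ∀ p ts → QuantifierFree (rel p ts)
    ¬′_  : ∀ {φ} → QuantifierFree φ → QuantifierFree (¬′ φ)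
    _∧′_ : ∀ {φ χ} → QuantifierFree φ → QuantifierFree χ → QuantifierFree (φ ∧′ χ)
    _∨′_ : ∀ {φ χ} → QuantifierFree φ → QuantifierFree χ → QuantifierFree (φ ∨′ χ)
    _⇒′_ : ∀ {φ χ} → QuantifierFree φ → QuantifierFree χ → QuantifierFree (φ ⇒′ χ)

-- Values in the domains D for the variables V.
Env : {Sort : Set} → (Sort → Set) → (Sort → Set) → Set
Env D V = ∀ σ → V σ → D σ

emptyEnv : {Sort : Set} {D : Sort → Set} → Env D (λ _ → ⊥)
emptyEnv _ ()

extend : {Sort : Set} {D V : Sort → Set} {τ : Sort} → Env D V → D τ → Env D (V ▸ τ)
extend ρ a _ new     = a
extend ρ a σ (old x) = ρ σ x

record Structure {Sort : Set} (Sg : Signature Sort) : Set₁ where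
  open Signature Sg
  field
    Dom      : Sort → Set
    nonempty : ∀ σ → Dom σ
    ⟦_⟧ᶠ     : (f : Fun) → All Dom (dom f) → Dom (cod f)
    ⟦_⟧ʳ     : (p : Rel) → All Dom (args p) → Set

module _ {Sort : Set} {Sg : Signature Sort} (A : Structure Sg) where

  open Structure A

  eval  : ∀ {V σ} → Env Dom V → Term Sg V σ → Dom σ
  evals : ∀ {V σs} → Env Dom V → All (Term Sg V) σs → All Dom σs

  eval ρ (var x)    = ρ _ x
  eval ρ (app f ts) = ⟦ f ⟧ᶠ (evals ρ ts)

  evals ρ []       = []
  evals ρ (t ∷ ts) = eval ρ t ∷ evals ρ ts

  Sat : ∀ {V} → Env Dom V → Formula Sg V → Set
  Sat ρ (t ≐ u)    = eval ρ t ≡ eval ρ u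
  Sat ρ (rel p ts) = ⟦ p ⟧ʳ (evals ρ ts)
  Sat ρ (¬′ φ)     = ¬ Sat ρ φ
  Sat ρ (φ ∧′ χ)   = Sat ρ φ × Sat ρ χ
  Sat ρ (φ ∨′ χ)   = Sat ρ φ ⊎ Sat ρ χ
  Sat ρ (φ ⇒′ χ)   = Sat ρ φ → Sat ρ χ
  Sat ρ (∀′ τ φ)   = (a : Dom τ) → Sat (extend ρ a) φ
  Sat ρ (∃′ τ φ)   = ∃[ a ] Sat (extend ρ a) φ

record Interpretation {Sort : Set} (Sg : Signature Sort) : Set₁ where
  field
    structure : Structure Sg
  open Structure structure public
  field
    value : Env Dom Var

Finite : Set → Set
Finite X = ∃[ k ] (X ↔ Fin k)

module _ {Sort : Set} {Sg : Signature Sort} where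

  open Interpretation

  infix 4 _⊨_ _⊨ˢ_

  _⊨_ : Interpretation Sg → Formula Sg Var → Set
  A ⊨ φ = Sat (structure A) (value A) φ

  _⊨ˢ_ : Interpretation Sg → Sentence Sg → Set
  A ⊨ˢ φ = Sat (structure A) emptyEnv φ

  -- The class of T-interpretations.
  Models : Theory Sg → Pred (Interpretation Sg) 0ℓ
  Models T A = ∀ φ → φ ∈ T → A ⊨ˢ φ

  Satisfiable : Theory Sg → Formula Sg Var → Set₁
  Satisfiable T φ = ∃[ A ] (A ∈ Models T × A ⊨ φ)

  FiniteModelProperty : Theory Sg → Pred Sort 0ℓ → Set₁
  FiniteModelProperty T S =
    ∀ φ → QuantifierFree φ → Satisfiable T φ →
    ∃[ A ] (A ∈ Models T × A ⊨ φ × (∀ τ → τ ∈ S → Finite (Dom A τ)))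

  -- |Y| ≤ |X| is the existence of an injection Y ↣ X.
  StablyFinite : Theory Sg → Pred Sort 0ℓ → Set₁
  StablyFinite T S =
    ∀ φ → QuantifierFree φ → ∀ A → A ∈ Models T → A ⊨ φ →
    ∃[ B ] (B ∈ Models T × B ⊨ φ ×
            (∀ τ → τ ∈ S → Finite (Dom B τ) × (Dom B τ ↣ Dom A τ)))

emptySignature : (Sort : Set) → Signature Sort
emptySignature Sort = record
  { Fun = ⊥ ; dom = ⊥-elim ; cod = ⊥-elim ; Rel = ⊥ ; args = ⊥-elim }

-- A single function symbol, of arity σ → σ.
unarySignature : (Sort : Set) → Sort → Signature Sort
unarySignature Sort σ = record
  { Fun = ⊤ ; dom = λ _ → σ ∷ [] ; cod = λ _ → σ ; Rel = ⊥ ; args = ⊥-elim }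

-- Formulas over the empty signature, read over a larger signature with the
-- same sorts.
module _ {Sort : Set} {Sg : Signature Sort} where

  embedTerm : ∀ {V σ} → Term (emptySignature Sort) V σ → Term Sg V σ
  embedTerm (var x) = var x

  embed : ∀ {V} → Formula (emptySignature Sort) V → Formula Sg V
  embed (t ≐ u)  = embedTerm t ≐ embedTerm u
  embed (¬′ φ)   = ¬′ embed φ
  embed (φ ∧′ χ) = embed φ ∧′ embed χ
  embed (φ ∨′ χ) = embed φ ∨′ embed χ
  embed (φ ⇒′ χ) = embed φ ⇒′ embed χ
  embed (∀′ τ φ) = ∀′ τ (embed φ)
  embed (∃′ τ φ) = ∃′ τ (embed φ)

module _ {Sort : Set} (σ : Sort) where

  s : ∀ {V} → Term (unarySignature Sort σ) V σ → Term (unarySignature Sort σ) V σ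
  s t = app tt (t ∷ [])

  ψ∨ : Sentence (unarySignature Sort σ)
  ψ∨ = ∀′ σ ((s (s x) ≐ x) ∨′ (s (s x) ≐ s x))
    where x = var new

  data AddUnary (T : Theory (emptySignature Sort)) : Theory (unarySignature Sort σ) where
    old-axiom : ∀ {φ} → φ ∈ T → embed φ ∈ AddUnary T
    new-axiom : ψ∨ ∈ AddUnary T

{-# OPTIONS --safe #-}

-- From T to T′: under ψ∨ one has s(s(s(x))) = s(x), so in a quantifier-free φ
-- every term is equal to x, s(x) or s(s(x)) for some variable x.  Renaming
-- these to fresh variables and adding, for the finitely many variables of φ,
-- the instances of congruence and of ψ∨ gives a quantifier-free formula over
-- the empty signature.  A model of T′ and φ is a model of T and this formula;
-- conversely, in a model of the formula with decidable equality, s can be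
-- defined on the values of the fresh variables, and as the identity elsewhere.
-- From T′ to T: expand by s = id, and take the reduct.

module Submission where

open import Data.Fin.Base using (Fin; zero; suc; toℕ)
open import Data.Fin.Patterns using (0F; 1F; 2F)
open import Data.Fin.Properties using (inj⇒≟)
open import Data.List.Base using (List; []; _∷_; _++_; allFin; cartesianProduct)
open import Data.List.Membership.Propositional using (find; lose) renaming (_∈_ to _∈ˡ_)
open import Data.List.Membership.Propositional.Properties
  using (∈-allFin; ∈-cartesianProduct⁺; ∈-cartesianProduct⁻)
open import Data.List.Relation.Binary.Subset.Propositional using (_⊆_)
open import Data.List.Relation.Binary.Subset.Propositional.Properties
  using (⊆-refl; ⊆-trans; xs⊆xs++ys; xs⊆ys++xs)
open import Data.List.Relation.Unary.All using (All; []; _∷_)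
open import Data.List.Relation.Unary.Any using (here; there; any?)
open import Data.Nat.Base using (ℕ; suc; _+_; _*_)
open import Data.Product.Base using (_×_; _,_; proj₁; proj₂; map₂; ∃-syntax)
open import Data.Product.Function.NonDependent.Propositional using (_×-⇔_)
open import Data.Sum.Base using (_⊎_; inj₁; inj₂; [_,_]′)
open import Data.Sum.Function.Propositional using (_⊎-⇔_)
open import Function.Base using (_∘_)
open import Function.Bundles using (_⇔_; mk⇔; Equivalence)
open import Function.Construct.Identity using (⇔-id)
open import Function.Properties.Inverse using (↔⇒↣)
open import Function.Related.TypeIsomorphisms using (→-cong-⇔; ¬-cong-⇔)
open import Relation.Binary.Definitions using (DecidableEquality)
open import Relation.Binary.PropositionalEquality.Core
  using (_≡_; refl; sym; trans; cong)
open import Relation.Nullary.Decidable.Core using (Dec; yes; no)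
open import Relation.Nullary.Negation.Core using (contradiction)
open import Relation.Unary using (U; _∈_)
open import Defs

open Interpretation
open Equivalence

-- The logic is constructive, so defining s by cases on values needs decidable equality; finiteness
-- of the domain supplies it.
Finite⇒≟ : ∀ {X} → Finite X → DecidableEquality X
Finite⇒≟ (_ , X↔k) = inj⇒≟ (↔⇒↣ X↔k)

≡-cong-⇔ : {X : Set} {x x′ y y′ : X} → x ≡ x′ → y ≡ y′ → (x ≡ y) ⇔ (x′ ≡ y′)
≡-cong-⇔ refl refl = ⇔-id _

-- Expansions and reducts.

module _ {Sort : Set} {Sg : Signature Sort} where

  open Signature Sg

  expand : (A : Structure (emptySignature Sort)) → let D = Structure.Dom A in
    ((f : Fun) → All D (dom f) → D (cod f)) →
    ((p : Rel) → All D (args p) → Set) → Structure Sg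
  expand A F R = record
    { Dom      = Structure.Dom A
    ; nonempty = Structure.nonempty A
    ; ⟦_⟧ᶠ     = F
    ; ⟦_⟧ʳ     = R
    }

  reduct : Structure Sg → Structure (emptySignature Sort)
  reduct A = record
    { Dom      = Structure.Dom A
    ; nonempty = Structure.nonempty A
    ; ⟦_⟧ᶠ     = λ ()
    ; ⟦_⟧ʳ     = λ ()
    }

  -- Every term over the empty signature is a variable, so `F` and `R` are never consulted. By eta a
  -- structure for `Sg` is the expansion of its reduct, so this serves reducts as well.
  Sat-embed : ∀ A {F R V} (ρ : Env (Structure.Dom A) V) φ →
    Sat A ρ φ ⇔ Sat (expand A F R) ρ (embed φ)
  Sat-embed A ρ (var x ≐ var y) = ⇔-id _
  Sat-embed A ρ (¬′ φ)   = ¬-cong-⇔ (Sat-embed A ρ φ)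
  Sat-embed A ρ (φ ∧′ χ) = Sat-embed A ρ φ ×-⇔ Sat-embed A ρ χ
  Sat-embed A ρ (φ ∨′ χ) = Sat-embed A ρ φ ⊎-⇔ Sat-embed A ρ χ
  Sat-embed A ρ (φ ⇒′ χ) = →-cong-⇔ (Sat-embed A ρ φ) (Sat-embed A ρ χ)
  Sat-embed A ρ (∀′ τ φ) = mk⇔
    (λ h a → to   (Sat-embed A (extend ρ a) φ) (h a))
    (λ h a → from (Sat-embed A (extend ρ a) φ) (h a))
  Sat-embed A ρ (∃′ τ φ) = mk⇔
    (map₂ λ {a} → to   (Sat-embed A (extend ρ a) φ))
    (map₂ λ {a} → from (Sat-embed A (extend ρ a) φ))

  QuantifierFree-embed : ∀ {V} {φ : Formula (emptySignature Sort) V} →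
    QuantifierFree φ → QuantifierFree (embed {Sg = Sg} φ)
  QuantifierFree-embed (t ≐ u)  = embedTerm t ≐ embedTerm u
  QuantifierFree-embed (¬′ q)   = ¬′ QuantifierFree-embed q
  QuantifierFree-embed (q ∧′ r) = QuantifierFree-embed q ∧′ QuantifierFree-embed r
  QuantifierFree-embed (q ∨′ r) = QuantifierFree-embed q ∨′ QuantifierFree-embed r
  QuantifierFree-embed (q ⇒′ r) = QuantifierFree-embed q ⇒′ QuantifierFree-embed r

-- Adding finitely many laws to a formula.

module _ {Sort I : Set} {Sg : Signature Sort} {V : Sort → Set}
         (law : I → Formula Sg V) (φ : Formula Sg V) where

  -- Formulas have no truth constant, so `φ` itself closes the conjunction.
  conjoin : List I → Formula Sg V
  conjoin []       = φ
  conjoin (i ∷ is) = law i ∧′ conjoin is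

  QuantifierFree-conjoin : (∀ i → QuantifierFree (law i)) → QuantifierFree φ →
    ∀ is → QuantifierFree (conjoin is)
  QuantifierFree-conjoin ql q []       = q
  QuantifierFree-conjoin ql q (i ∷ is) = ql i ∧′ QuantifierFree-conjoin ql q is

  module _ (A : Structure Sg) {ρ : Env (Structure.Dom A) V} where

    Sat-conjoin⁺ : (∀ i → Sat A ρ (law i)) → Sat A ρ φ → ∀ is → Sat A ρ (conjoin is)
    Sat-conjoin⁺ ⊨law ⊨φ []       = ⊨φ
    Sat-conjoin⁺ ⊨law ⊨φ (i ∷ is) = ⊨law i , Sat-conjoin⁺ ⊨law ⊨φ is

    Sat-conjoin⁻ : ∀ is → Sat A ρ (conjoin is) → Sat A ρ φ
    Sat-conjoin⁻ []       ⊨φ      = ⊨φ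
    Sat-conjoin⁻ (_ ∷ is) (_ , h) = Sat-conjoin⁻ is h

    Sat-law : ∀ is → Sat A ρ (conjoin is) → ∀ {i} → i ∈ˡ is → Sat A ρ (law i)
    Sat-law (_ ∷ is) (⊨law , _) (here refl) = ⊨law
    Sat-law (_ ∷ is) (_ , h)    (there i∈)  = Sat-law is h i∈

-- Points and their coding as variables.

-- The point (i , x) stands for the term sⁱ(x).
Point : Set
Point = Fin 3 × ℕ

-- s(s(s(x))) = s(x), hence the successor of 2 is 1.
next : Point → Point
next (0F , x) = 1F , x
next (1F , x) = 2F , x
next (2F , x) = 1F , x

-- Fresh variables must come from the same supply ℕ: the exponent of s becomes the remainder modulo
-- 3, the variable the quotient.
encode : Point → ℕ
encode (i , x) = toℕ i + x * 3

decode : ℕ → Point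
decode 0 = 0F , 0
decode 1 = 1F , 0
decode 2 = 2F , 0
decode (suc (suc (suc n))) = map₂ suc (decode n)

decode-encode : ∀ p → decode (encode p) ≡ p
decode-encode (0F , 0)     = refl
decode-encode (1F , 0)     = refl
decode-encode (2F , 0)     = refl
decode-encode (0F , suc x) = cong (map₂ suc) (decode-encode (0F , x))
decode-encode (1F , suc x) = cong (map₂ suc) (decode-encode (1F , x))
decode-encode (2F , suc x) = cong (map₂ suc) (decode-encode (2F , x))

-- The translation into the empty signature.

module _ {m : ℕ} where

  private
    E = emptySignature (Fin (suc m))
    S = unarySignature (Fin (suc m)) zero

  point : ∀ {σ} → Term S Var σ → Point
  point (var x)          = 0F , x
  point (app _ (t ∷ [])) = next (point t)

  root : ∀ {σ} → Term S Var σ → ℕ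
  root (var x)          = x
  root (app _ (t ∷ [])) = root t

  -- Sorts are forgotten: a variable of another sort merely contributes further instances of the
  -- laws at sort `zero`, which hold in every reduct.
  roots : ∀ {φ : Formula S Var} → QuantifierFree φ → List ℕ
  roots (t ≐ u)  = root t ∷ root u ∷ []
  roots (¬′ q)   = roots q
  roots (q ∧′ r) = roots q ++ roots r
  roots (q ∨′ r) = roots q ++ roots r
  roots (q ⇒′ r) = roots q ++ roots r

  pointVar : ∀ σ → Point → Term E Var σ
  pointVar _ = var ∘ encode

  flatten : ∀ {φ : Formula S Var} → QuantifierFree φ → Formula E Var
  flatten (_≐_ {σ} t u) = pointVar σ (point t) ≐ pointVar σ (point u)
  flatten (¬′ q)        = ¬′ flatten q
  flatten (q ∧′ r)      = flatten q ∧′ flatten r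
  flatten (q ∨′ r)      = flatten q ∨′ flatten r
  flatten (q ⇒′ r)      = flatten q ⇒′ flatten r

  QuantifierFree-flatten : ∀ {φ} (q : QuantifierFree φ) → QuantifierFree (flatten q)
  QuantifierFree-flatten (t ≐ u)  = pointVar _ (point t) ≐ pointVar _ (point u)
  QuantifierFree-flatten (¬′ q)   = ¬′ QuantifierFree-flatten q
  QuantifierFree-flatten (q ∧′ r) = QuantifierFree-flatten q ∧′ QuantifierFree-flatten r
  QuantifierFree-flatten (q ∨′ r) = QuantifierFree-flatten q ∨′ QuantifierFree-flatten r
  QuantifierFree-flatten (q ⇒′ r) = QuantifierFree-flatten q ⇒′ QuantifierFree-flatten r

  -- Agreement of values at the atoms suffices. It is required only for terms rooted in `xs`,
  -- because a constructed s is controlled only there; `xs` stays fixed while the recursion descends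
  -- to subformulas.
  Sat-flatten : (A : Structure E) → ∀ {F R} (ρ θ : Env (Structure.Dom A) Var)
    (xs : List ℕ) →
    (∀ {σ} (t : Term S Var σ) → root t ∈ˡ xs →
      eval (expand A F R) ρ t ≡ θ σ (encode (point t))) →
    ∀ {φ} (q : QuantifierFree φ) → roots q ⊆ xs →
    Sat (expand A F R) ρ φ ⇔ Sat A θ (flatten q)
  Sat-flatten A {F} {R} ρ θ xs eval≡ = go
    where
    go : ∀ {φ} (q : QuantifierFree φ) → roots q ⊆ xs →
         Sat (expand A F R) ρ φ ⇔ Sat A θ (flatten q)
    go (t ≐ u)  ⊆xs = ≡-cong-⇔ (eval≡ t (⊆xs (here refl)))
                               (eval≡ u (⊆xs (there (here refl))))
    go (¬′ q)   ⊆xs = ¬-cong-⇔ (go q ⊆xs)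
    go (q ∧′ r) ⊆xs = go q (⊆-trans (xs⊆xs++ys _ _) ⊆xs) ×-⇔
                      go r (⊆-trans (xs⊆ys++xs _ _) ⊆xs)
    go (q ∨′ r) ⊆xs = go q (⊆-trans (xs⊆xs++ys _ _) ⊆xs) ⊎-⇔
                      go r (⊆-trans (xs⊆ys++xs _ _) ⊆xs)
    go (q ⇒′ r) ⊆xs = →-cong-⇔ (go q (⊆-trans (xs⊆xs++ys _ _) ⊆xs))
                               (go r (⊆-trans (xs⊆ys++xs _ _) ⊆xs))

  -- The first conjunct makes s well defined on values of points; the second is the instance of `ψ∨`
  -- at `p`, with `next` in place of s.
  law : Point × Point → Formula E Var
  law (p , q) =
    (v p ≐ v q ⇒′ v (next p) ≐ v (next q)) ∧′
    (v (next (next p)) ≐ v p ∨′ v (next (next p)) ≐ v (next p))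
    where v = pointVar zero

  QuantifierFree-law : ∀ pq → QuantifierFree (law pq)
  QuantifierFree-law _ = (_ ≐ _ ⇒′ _ ≐ _) ∧′ (_ ≐ _ ∨′ _ ≐ _)

  points : List ℕ → List Point
  points = cartesianProduct (allFin 3)

  -- This closure allows s to be iterated without leaving the points whose laws are in the
  -- translation.
  next∈points : ∀ xs p → p ∈ˡ points xs → next p ∈ˡ points xs
  next∈points xs p p∈ = ∈-cartesianProduct⁺ (∈-allFin _) (x∈ p p∈)
    where
    -- The variable is unchanged by `next`, but this computes only once the exponent is known.
    x∈ : ∀ p → p ∈ˡ points xs → proj₂ (next p) ∈ˡ xs
    x∈ (0F , x) = proj₂ ∘ ∈-cartesianProduct⁻ (allFin 3) xs
    x∈ (1F , x) = proj₂ ∘ ∈-cartesianProduct⁻ (allFin 3) xs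
    x∈ (2F , x) = proj₂ ∘ ∈-cartesianProduct⁻ (allFin 3) xs

  point∈points : ∀ {σ} xs (t : Term S Var σ) → root t ∈ˡ xs → point t ∈ˡ points xs
  point∈points xs (var x)          x∈    = ∈-cartesianProduct⁺ (∈-allFin 0F) x∈
  point∈points xs (app _ (t ∷ [])) root∈ = next∈points xs (point t) (point∈points xs t root∈)

  pairs : List ℕ → List (Point × Point)
  pairs xs = cartesianProduct (points xs) (points xs)

  translation : ∀ {φ} → QuantifierFree φ → Formula E Var
  translation q = conjoin law (flatten q) (pairs (roots q))

  QuantifierFree-translation : ∀ {φ} (q : QuantifierFree φ) →
    QuantifierFree (translation q)
  QuantifierFree-translation q =
    QuantifierFree-conjoin law (flatten q) QuantifierFree-law (QuantifierFree-flatten q)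
      (pairs (roots q))

  -- From models of T′ to models of the translation.

  module _ (T : Theory E) where

    private T′ = AddUnary zero T

    reduct-models : ∀ A → A ∈ Models T′ →
      ∀ χ → χ ∈ T → Sat (reduct (structure A)) emptyEnv χ
    reduct-models A A⊨T′ χ χ∈T = from (Sat-embed _ _ χ) (A⊨T′ _ (old-axiom χ∈T))

    module Reduct (A : Interpretation S) (A⊨T′ : A ∈ Models T′) where

      private
        D = Dom A

        sᴬ : D zero → D zero
        sᴬ a = ⟦ A ⟧ᶠ _ (a ∷ [])

        ss : ∀ a → sᴬ (sᴬ a) ≡ a ⊎ sᴬ (sᴬ a) ≡ sᴬ a
        ss = A⊨T′ _ new-axiom

        sss : ∀ a → sᴬ (sᴬ (sᴬ a)) ≡ sᴬ a
        sss a = [ cong sᴬ , (λ eq → trans (cong sᴬ eq) eq) ]′ (ss a)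

        -- Only points (0 , x) arise from terms of the sorts other than zero.
        pointValue : ∀ σ → Point → D σ
        pointValue zero    (0F , x) = value A zero x
        pointValue zero    (1F , x) = sᴬ (value A zero x)
        pointValue zero    (2F , x) = sᴬ (sᴬ (value A zero x))
        pointValue (suc σ) (_  , x) = value A (suc σ) x

        pointValue-next : ∀ p → pointValue zero (next p) ≡ sᴬ (pointValue zero p)
        pointValue-next (0F , x) = refl
        pointValue-next (1F , x) = refl
        pointValue-next (2F , x) = sym (sss _)

        pointValue-point : ∀ {σ} (t : Term S Var σ) →
          eval (structure A) (value A) t ≡ pointValue σ (point t)
        pointValue-point {zero}  (var x) = refl
        pointValue-point {suc σ} (var x) = refl
        pointValue-point (app _ (t ∷ [])) =
          trans (cong sᴬ (pointValue-point t)) (sym (pointValue-next (point t)))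

        θ : Env D Var
        θ σ = pointValue σ ∘ decode

        θ-encode : ∀ σ p → θ σ (encode p) ≡ pointValue σ p
        θ-encode σ p = cong (pointValue σ) (decode-encode p)

        θ-next : ∀ p → θ zero (encode (next p)) ≡ sᴬ (θ zero (encode p))
        θ-next p rewrite θ-encode zero (next p) | θ-encode zero p = pointValue-next p

        -- Under `θ`, `next` acts as the actual function `sᴬ`, which respects equality and satisfies
        -- `ψ∨`.
        ⊨law : ∀ pq → Sat (reduct (structure A)) θ (law pq)
        ⊨law (p , q)
          rewrite θ-next (next p) | θ-next p | θ-next q = cong sᴬ , ss _

      interpretation : Interpretation E
      interpretation = record { structure = reduct (structure A) ; value = θ }

      models : interpretation ∈ Models T
      models = reduct-models A A⊨T′

      ⊨translation : ∀ {φ} (q : QuantifierFree φ) → A ⊨ φ → interpretation ⊨ translation q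
      ⊨translation q ⊨φ =
        Sat-conjoin⁺ law (flatten q) _ ⊨law
          (to (Sat-flatten (reduct (structure A)) (value A) θ (roots q)
                (λ t _ → trans (pointValue-point t) (sym (θ-encode _ (point t)))) q ⊆-refl) ⊨φ)
          (pairs (roots q))

    -- From models of the translation to models of T′.

    module Expansion (B : Interpretation E) (B⊨T : B ∈ Models T)
                     (_≟_ : DecidableEquality (Dom B zero))
                     {φ : Formula S Var} (q : QuantifierFree φ)
                     (⊨tr : B ⊨ translation q) where

      private
        ps = points (roots q)

        ⟪_⟫ : Point → Dom B zero
        ⟪ p ⟫ = value B zero (encode p)

        ⊨law : ∀ {p r} → p ∈ˡ ps → r ∈ˡ ps → Sat (structure B) (value B) (law (p , r))
        ⊨law p∈ r∈ =
          Sat-law law (flatten q) _ (pairs (roots q)) ⊨tr (∈-cartesianProduct⁺ p∈ r∈)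

        find? : ∀ b → Dec (∃[ p ] (p ∈ˡ ps × b ≡ ⟪ p ⟫))
        find? b with any? (λ p → b ≟ ⟪ p ⟫) ps
        ... | yes any = yes (find any)
        ... | no ¬any = no λ (_ , p∈ , eq) → ¬any (lose p∈ eq)

        sᴮ : Dom B zero → Dom B zero
        sᴮ b with find? b
        ... | yes (p , _) = ⟪ next p ⟫
        ... | no _        = b

        -- The search may return another point `r` with the same value as `p`; the congruence law
        -- for `(p , r)` makes the choice irrelevant.
        sᴮ-point : ∀ {p} → p ∈ˡ ps → sᴮ ⟪ p ⟫ ≡ ⟪ next p ⟫
        sᴮ-point {p} p∈ with find? ⟪ p ⟫
        ... | yes (r , r∈ , eq) = sym (proj₁ (⊨law p∈ r∈) eq)
        ... | no ∄p             = contradiction (p , p∈ , refl) ∄p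

        ss : ∀ b → sᴮ (sᴮ b) ≡ b ⊎ sᴮ (sᴮ b) ≡ sᴮ b
        ss b with find? b in eq
        ... | yes (p , p∈ , refl)
                -- Since `next p` is again listed, the outer application yields `⟪ next (next p) ⟫`,
                -- and the goal is the second law at `p`.
                rewrite sᴮ-point (next∈points (roots q) p p∈) = proj₂ (⊨law p∈ p∈)
        -- Here s fixes `b`, so the outer application repeats the same failed search, which `eq`
        -- resolves.
        ... | no _ rewrite eq = inj₁ refl

      interpretation : Interpretation S
      interpretation = record
        { structure = expand (structure B) (λ { _ (b ∷ []) → sᴮ b }) (λ ())
        -- The original variable x was renamed to the code of s⁰(x), at every sort.
        ; value     = λ σ x → value B σ (encode (0F , x))
        }

      models : interpretation ∈ Models T′
      models _ (old-axiom {χ} χ∈T) = to (Sat-embed _ _ χ) (B⊨T χ χ∈T)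
      models _ new-axiom = ss

      ⊨formula : interpretation ⊨ φ
      ⊨formula = from (Sat-flatten (structure B) _ (value B) (roots q) eval≡ q ⊆-refl)
                      (Sat-conjoin⁻ law (flatten q) (structure B) (pairs (roots q)) ⊨tr)
        where
        eval≡ : ∀ {σ} (t : Term S Var σ) → root t ∈ˡ roots q →
          eval (structure interpretation) (value interpretation) t ≡
          value B σ (encode (point t))
        eval≡ (var x)          _     = refl
        eval≡ (app _ (t ∷ [])) root∈ =
          trans (cong sᴮ (eval≡ t root∈)) (sᴮ-point (point∈points (roots q) t root∈))

    -- Expansion by the identity, and plain reducts.

    trivialExpansion : Interpretation E → Interpretation S
    trivialExpansion A = record
      { structure = expand (structure A) (λ { _ (a ∷ []) → a }) (λ ())
      ; value     = value A
      }

    trivialExpansion-models : ∀ A → A ∈ Models T → trivialExpansion A ∈ Models T′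
    trivialExpansion-models A A⊨T _ (old-axiom {χ} χ∈T) = to (Sat-embed _ _ χ) (A⊨T χ χ∈T)
    trivialExpansion-models A A⊨T _ new-axiom           = λ _ → inj₁ refl

    trivialExpansion-⊨ : ∀ A φ → A ⊨ φ → trivialExpansion A ⊨ embed φ
    trivialExpansion-⊨ A φ = to (Sat-embed (structure A) (value A) φ)

    reductInterpretation : Interpretation S → Interpretation E
    reductInterpretation B = record { structure = reduct (structure B) ; value = value B }

    reductInterpretation-⊨ : ∀ B φ → B ⊨ embed φ → reductInterpretation B ⊨ φ
    reductInterpretation-⊨ B φ = from (Sat-embed (reduct (structure B)) (value B) φ)

    -- Transfer of the two properties.

    FiniteModelProperty⁺ : FiniteModelProperty T U → FiniteModelProperty T′ U
    FiniteModelProperty⁺ fmp φ q (A , A⊨T′ , A⊨φ)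
      with B , B⊨T , B⊨tr , fin ← fmp (translation q) (QuantifierFree-translation q)
             (Reduct.interpretation A A⊨T′ , Reduct.models A A⊨T′ ,
              Reduct.⊨translation A A⊨T′ q A⊨φ)
      = interpretation , models , ⊨formula , fin
      -- Only the sort on which s acts needs decidable equality.
      where open Expansion B B⊨T (Finite⇒≟ (fin zero _)) q B⊨tr

    -- Reduct and expansion keep every domain, so the finiteness proofs and the injections into the
    -- domains of `A` carry over unchanged.
    StablyFinite⁺ : StablyFinite T U → StablyFinite T′ U
    StablyFinite⁺ sf φ q A A⊨T′ A⊨φ
      with B , B⊨T , B⊨tr , fin ← sf (translation q) (QuantifierFree-translation q)
             (Reduct.interpretation A A⊨T′) (Reduct.models A A⊨T′)
             (Reduct.⊨translation A A⊨T′ q A⊨φ)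
      = interpretation , models , ⊨formula , fin
      where open Expansion B B⊨T (Finite⇒≟ (proj₁ (fin zero _))) q B⊨tr

    FiniteModelProperty⁻ : FiniteModelProperty T′ U → FiniteModelProperty T U
    FiniteModelProperty⁻ fmp φ q (A , A⊨T , A⊨φ)
      with B , B⊨T′ , B⊨φ , fin ← fmp (embed φ) (QuantifierFree-embed q)
             (trivialExpansion A , trivialExpansion-models A A⊨T , trivialExpansion-⊨ A φ A⊨φ)
      = reductInterpretation B , reduct-models B B⊨T′
      , reductInterpretation-⊨ B φ B⊨φ , fin

    StablyFinite⁻ : StablyFinite T′ U → StablyFinite T U
    StablyFinite⁻ sf φ q A A⊨T A⊨φ
      with B , B⊨T′ , B⊨φ , fin ← sf (embed φ) (QuantifierFree-embed q)
             (trivialExpansion A) (trivialExpansion-models A A⊨T) (trivialExpansion-⊨ A φ A⊨φ)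
      = reductInterpretation B , reduct-models B B⊨T′
      , reductInterpretation-⊨ B φ B⊨φ , fin

theorem10 : (m : ℕ) (T : Theory (emptySignature (Fin (suc m)))) →
    (FiniteModelProperty T U ⇔ FiniteModelProperty (AddUnary zero T) U) ×
    (StablyFinite T U ⇔ StablyFinite (AddUnary zero T) U)
theorem10 m T =
  mk⇔ (FiniteModelProperty⁺ T) (FiniteModelProperty⁻ T) ,
  mk⇔ (StablyFinite⁺ T) (StablyFinite⁻ T)
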